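{- Let $n$ be a positive integer and $\mathbf b=(b_1,\dots,b_n)\in\mathbb Z_{>0}^n$. Then $\dim(\mathfrak X_n(\mathbf b))=n$, unless $n=1=b_1$, in which case $\dim(\mathfrak X_n(\mathbf b))=0$.
   Context: A $\mathbf b$-parking function is a list $(\beta_1,\dots,\beta_n)$ of positive integers whose nondecreasing rearrangement $\beta'_1\le\cdots\le\beta'_n$ satisfies $\beta'_i\le b_1+\cdots+b_i$ for all $1\le i\le n$. The $\mathbf b$-parking-function polytope $\mathfrak X_n(\mathbf b)\subset\mathbb R^n$ is the convex hull of all $\mathbf b$-parking functions. The dimension of a polytope is the dimension of its affine hull. -}

module Defs where

open import Algebra.Bundles using (CommutativeRing)
open import Data.Fin using (Fin; toℕ; inject≤)
open import Data.Fin.Properties using (toℕ<n)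
open import Data.Integer using (+_)
open import Data.Nat as ℕ using (ℕ; suc; _⊔_)
import Data.Nat.Properties as ℕ
open import Data.Product using (Σ-syntax; ∃-syntax; _×_; _,_)
open import Data.Rational as ℚ using (ℚ; 0ℚ; 1ℚ; ½; ∣_∣)
import Data.Rational.Properties as ℚ
open import Data.Vec.Functional using (Vector)
open import Data.Vec.Functional.Relation.Binary.Permutation using (_↭_)
open import Level using (0ℓ)
open import Relation.Binary.PropositionalEquality using (_≡_; refl; sym; cong; cong₂; subst)
open import Relation.Unary using (Pred; _∈_; _⊆_)

import Algebra.Properties.AbelianGroup
import Algebra.Properties.CommutativeSemigroup
import Algebra.Properties.Ring
import Algebra.Properties.Semiring.Sum as SemiringSum

------------------------------------------------------------------------
-- The real numbers, as Cauchy sequences of rationals carrying a modulus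
-- of convergence.  Two sequences represent the same real when their
-- difference tends to 0; all operations are pointwise.

Eventually : Pred (ℕ → Set) 0ℓ
Eventually P = ∃[ N ] ∀ n → N ℕ.≤ n → P n

record ℝ : Set where
  constructor mkℝ
  field
    approx : ℕ → ℚ
    cauchy : ∀ ε → 0ℚ ℚ.< ε →
             ∃[ N ] ∀ m n → N ℕ.≤ m → N ℕ.≤ n → ∣ approx m ℚ.- approx n ∣ ℚ.< ε

open ℝ public

infix 4 _≈_ _≤_
infixl 6 _+_
infixl 7 _*_
infix 8 -_

-- Records rather than plain function types, so that the two reals can be
-- inferred from the type of a proof.

record _≈_ (x y : ℝ) : Set where
  constructor mk≈
  field
    close : ∀ ε → 0ℚ ℚ.< ε → Eventually λ n → ∣ approx x n ℚ.- approx y n ∣ ℚ.< ε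

open _≈_ public

record _≤_ (x y : ℝ) : Set where
  constructor mk≤
  field
    below : ∀ ε → 0ℚ ℚ.< ε → Eventually λ n → approx x n ℚ.- approx y n ℚ.< ε

open _≤_ public

private
  module ℚ-group = Algebra.Properties.AbelianGroup ℚ.+-0-abelianGroup
  module ℚ-ring = Algebra.Properties.Ring ℚ.+-*-ring
  module ℚ-+ = Algebra.Properties.CommutativeSemigroup
    (CommutativeRing.+-commutativeSemigroup ℚ.+-*-commutativeRing)
  open ℚ.≤-Reasoning

  ∣q-q∣<ε : ∀ {q ε} → 0ℚ ℚ.< ε → ∣ q ℚ.- q ∣ ℚ.< ε
  ∣q-q∣<ε {q} 0<ε = subst (λ r → ∣ r ∣ ℚ.< _) (sym (ℚ.+-inverseʳ q)) 0<ε

  half : ∀ ε → 0ℚ ℚ.< ε → 0ℚ ℚ.< ε ℚ.* ½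
  half ε 0<ε = ℚ.*-monoˡ-<-pos ½ 0<ε

  half+half : ∀ ε → ε ℚ.* ½ ℚ.+ ε ℚ.* ½ ≡ ε
  half+half ε = begin-equality
    ε ℚ.* ½ ℚ.+ ε ℚ.* ½    ≡⟨ ℚ.*-distribˡ-+ ε ½ ½ ⟨
    ε ℚ.* 1ℚ               ≡⟨ ℚ.*-identityʳ ε ⟩
    ε                      ∎

  triangle : ∀ p q r → ∣ p ℚ.- r ∣ ℚ.≤ ∣ p ℚ.- q ∣ ℚ.+ ∣ q ℚ.- r ∣
  triangle p q r = begin
    ∣ p ℚ.- r ∣                            ≡⟨ cong (λ s → ∣ p ℚ.+ s ∣) (ℚ-group.\\-leftDividesʳ q (ℚ.- r)) ⟨
    ∣ p ℚ.+ (ℚ.- q ℚ.+ (q ℚ.- r)) ∣        ≡⟨ cong ∣_∣ (ℚ.+-assoc p (ℚ.- q) (q ℚ.- r)) ⟨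
    ∣ (p ℚ.- q) ℚ.+ (q ℚ.- r) ∣            ≤⟨ ℚ.∣p+q∣≤∣p∣+∣q∣ (p ℚ.- q) (q ℚ.- r) ⟩
    ∣ p ℚ.- q ∣ ℚ.+ ∣ q ℚ.- r ∣            ∎

  close-sym : ∀ {ε} p q → ∣ p ℚ.- q ∣ ℚ.< ε → ∣ q ℚ.- p ∣ ℚ.< ε
  close-sym {ε} p q h = subst (ℚ._< ε) (begin-equality
    ∣ p ℚ.- q ∣          ≡⟨ ℚ.∣-p∣≡∣p∣ (p ℚ.- q) ⟨
    ∣ ℚ.- (p ℚ.- q) ∣    ≡⟨ cong ∣_∣ (ℚ-group.⁻¹-anti-homo-// p q) ⟩
    ∣ q ℚ.- p ∣          ∎) h

  close-trans : ∀ {ε} p q r → ∣ p ℚ.- q ∣ ℚ.< ε ℚ.* ½ → ∣ q ℚ.- r ∣ ℚ.< ε ℚ.* ½ →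
                ∣ p ℚ.- r ∣ ℚ.< ε
  close-trans {ε} p q r h k = begin-strict
    ∣ p ℚ.- r ∣                    ≤⟨ triangle p q r ⟩
    ∣ p ℚ.- q ∣ ℚ.+ ∣ q ℚ.- r ∣    <⟨ ℚ.+-mono-< h k ⟩
    ε ℚ.* ½ ℚ.+ ε ℚ.* ½            ≡⟨ half+half ε ⟩
    ε                              ∎

  close-+ : ∀ {ε} p p′ q q′ → ∣ p ℚ.- p′ ∣ ℚ.< ε ℚ.* ½ → ∣ q ℚ.- q′ ∣ ℚ.< ε ℚ.* ½ →
            ∣ (p ℚ.+ q) ℚ.- (p′ ℚ.+ q′) ∣ ℚ.< ε
  close-+ {ε} p p′ q q′ h k = begin-strict
    ∣ (p ℚ.+ q) ℚ.- (p′ ℚ.+ q′) ∣              ≡⟨ cong (λ s → ∣ (p ℚ.+ q) ℚ.+ s ∣) (ℚ.neg-distrib-+ p′ q′) ⟩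
    ∣ (p ℚ.+ q) ℚ.+ (ℚ.- p′ ℚ.+ ℚ.- q′) ∣      ≡⟨ cong ∣_∣ (ℚ-+.interchange p q (ℚ.- p′) (ℚ.- q′)) ⟩
    ∣ (p ℚ.- p′) ℚ.+ (q ℚ.- q′) ∣              ≤⟨ ℚ.∣p+q∣≤∣p∣+∣q∣ (p ℚ.- p′) (q ℚ.- q′) ⟩
    ∣ p ℚ.- p′ ∣ ℚ.+ ∣ q ℚ.- q′ ∣              <⟨ ℚ.+-mono-< h k ⟩
    ε ℚ.* ½ ℚ.+ ε ℚ.* ½                        ≡⟨ half+half ε ⟩
    ε                                          ∎

  close-neg : ∀ {ε} p p′ → ∣ p ℚ.- p′ ∣ ℚ.< ε → ∣ (ℚ.- p) ℚ.- (ℚ.- p′) ∣ ℚ.< ε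
  close-neg {ε} p p′ h = subst (ℚ._< ε) (begin-equality
    ∣ p ℚ.- p′ ∣                  ≡⟨ ℚ.∣-p∣≡∣p∣ (p ℚ.- p′) ⟨
    ∣ ℚ.- (p ℚ.- p′) ∣            ≡⟨ cong ∣_∣ (ℚ.neg-distrib-+ p (ℚ.- p′)) ⟩
    ∣ (ℚ.- p) ℚ.- (ℚ.- p′) ∣      ∎) h

  close-* : ∀ {ε δ K L} p p′ q q′ → 0ℚ ℚ.< K → 0ℚ ℚ.< L → (K ℚ.+ L) ℚ.* δ ≡ ε →
            ∣ p ∣ ℚ.< K → ∣ q′ ∣ ℚ.< L → ∣ p ℚ.- p′ ∣ ℚ.< δ → ∣ q ℚ.- q′ ∣ ℚ.< δ →
            ∣ (p ℚ.* q) ℚ.- (p′ ℚ.* q′) ∣ ℚ.< ε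
  close-* {ε} {δ} {K} {L} p p′ q q′ 0<K 0<L eq p<K q′<L h k = begin-strict
    ∣ p ℚ.* q ℚ.- p′ ℚ.* q′ ∣                                    ≤⟨ triangle (p ℚ.* q) (p ℚ.* q′) (p′ ℚ.* q′) ⟩
    ∣ p ℚ.* q ℚ.- p ℚ.* q′ ∣ ℚ.+ ∣ p ℚ.* q′ ℚ.- p′ ℚ.* q′ ∣      ≡⟨ cong₂ (λ s t → ∣ s ∣ ℚ.+ ∣ t ∣) (ℚ-ring.x[y-z]≈xy-xz p q q′) eq′ ⟨
    ∣ p ℚ.* (q ℚ.- q′) ∣ ℚ.+ ∣ q′ ℚ.* (p ℚ.- p′) ∣               <⟨ ℚ.+-mono-< (bound p (q ℚ.- q′) 0<K p<K k) (bound q′ (p ℚ.- p′) 0<L q′<L h) ⟩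
    K ℚ.* δ ℚ.+ L ℚ.* δ                                          ≡⟨ ℚ.*-distribʳ-+ δ K L ⟨
    (K ℚ.+ L) ℚ.* δ                                              ≡⟨ eq ⟩
    ε                                                            ∎
    where
    eq′ : q′ ℚ.* (p ℚ.- p′) ≡ p ℚ.* q′ ℚ.- p′ ℚ.* q′
    eq′ = begin-equality
      q′ ℚ.* (p ℚ.- p′)             ≡⟨ ℚ.*-comm q′ (p ℚ.- p′) ⟩
      (p ℚ.- p′) ℚ.* q′             ≡⟨ ℚ-ring.[y-z]x≈yx-zx q′ p p′ ⟩
      p ℚ.* q′ ℚ.- p′ ℚ.* q′        ∎
    bound : ∀ {B} a d → 0ℚ ℚ.< B → ∣ a ∣ ℚ.< B → ∣ d ∣ ℚ.< δ → ∣ a ℚ.* d ∣ ℚ.< B ℚ.* δ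
    bound {B} a d 0<B a<B d<δ = begin-strict
      ∣ a ℚ.* d ∣        ≡⟨ ℚ.∣p*q∣≡∣p∣*∣q∣ a d ⟩
      ∣ a ∣ ℚ.* ∣ d ∣    ≤⟨ ℚ.*-monoʳ-≤-nonNeg ∣ d ∣ {{ℚ.nonNegative (ℚ.0≤∣p∣ d)}} (ℚ.<⇒≤ a<B) ⟩
      B ℚ.* ∣ d ∣        <⟨ ℚ.*-monoʳ-<-pos B {{ℚ.positive 0<B}} d<δ ⟩
      B ℚ.* δ            ∎

  divide : ∀ M ε → 0ℚ ℚ.< M → 0ℚ ℚ.< ε → Σ[ δ ∈ ℚ ] 0ℚ ℚ.< δ × M ℚ.* δ ≡ ε
  divide M ε 0<M 0<ε = δ , 0<δ , eq
    where
    instance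
      M>0 : ℚ.Positive M
      M>0 = ℚ.positive 0<M
      M≢0 : ℚ.NonZero M
      M≢0 = ℚ.pos⇒nonZero M
    δ : ℚ
    δ = ℚ.1/ M ℚ.* ε
    0<δ : 0ℚ ℚ.< δ
    0<δ = subst (ℚ._< δ) (ℚ.*-zeroʳ (ℚ.1/ M))
            (ℚ.*-monoʳ-<-pos (ℚ.1/ M) {{ℚ.1/pos⇒pos M}} 0<ε)
    eq : M ℚ.* δ ≡ ε
    eq = begin-equality
      M ℚ.* (ℚ.1/ M ℚ.* ε)   ≡⟨ ℚ.*-assoc M (ℚ.1/ M) ε ⟨
      (M ℚ.* ℚ.1/ M) ℚ.* ε   ≡⟨ cong (ℚ._* ε) (ℚ.*-inverseʳ M) ⟩
      1ℚ ℚ.* ε               ≡⟨ ℚ.*-identityˡ ε ⟩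
      ε                      ∎

  bounded : ∀ x → Σ[ K ∈ ℚ ] 0ℚ ℚ.< K × Eventually λ n → ∣ approx x n ∣ ℚ.< K
  bounded x with cauchy x 1ℚ (ℚ.positive⁻¹ 1ℚ)
  ... | N , h = K , 0<K , N , λ n N≤n → begin-strict
      ∣ approx x n ∣                                        ≡⟨ cong ∣_∣ (ℚ-group.xyx⁻¹≈y (approx x N) (approx x n)) ⟨
      ∣ (approx x N ℚ.+ approx x n) ℚ.- approx x N ∣        ≡⟨ cong ∣_∣ (ℚ.+-assoc (approx x N) (approx x n) _) ⟩
      ∣ approx x N ℚ.+ (approx x n ℚ.- approx x N) ∣        ≤⟨ ℚ.∣p+q∣≤∣p∣+∣q∣ (approx x N) _ ⟩
      ∣ approx x N ∣ ℚ.+ ∣ approx x n ℚ.- approx x N ∣      <⟨ ℚ.+-monoʳ-< ∣ approx x N ∣ (h n N N≤n ℕ.≤-refl) ⟩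
      K                                                     ∎
    where
    K : ℚ
    K = ∣ approx x N ∣ ℚ.+ 1ℚ
    0<K : 0ℚ ℚ.< K
    0<K = ℚ.+-mono-≤-< (ℚ.0≤∣p∣ (approx x N)) (ℚ.positive⁻¹ 1ℚ)

fromℚ : ℚ → ℝ
fromℚ q = mkℝ (λ _ → q) λ ε 0<ε → 0 , λ _ _ _ _ → ∣q-q∣<ε {q} 0<ε

fromℕ : ℕ → ℝ
fromℕ k = fromℚ (+ k ℚ./ 1)

0ℝ 1ℝ : ℝ
0ℝ = fromℚ 0ℚ
1ℝ = fromℚ 1ℚ

_+_ : ℝ → ℝ → ℝ
approx (x + y) n = approx x n ℚ.+ approx y n
cauchy (x + y) ε 0<ε with cauchy x (ε ℚ.* ½) (half ε 0<ε) | cauchy y (ε ℚ.* ½) (half ε 0<ε)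
... | M , h | N , k = M ⊔ N , λ m n p q →
  close-+ (approx x m) (approx x n) (approx y m) (approx y n)
    (h m n (ℕ.m⊔n≤o⇒m≤o M N p) (ℕ.m⊔n≤o⇒m≤o M N q))
    (k m n (ℕ.m⊔n≤o⇒n≤o M N p) (ℕ.m⊔n≤o⇒n≤o M N q))

-_ : ℝ → ℝ
approx (- x) n = ℚ.- approx x n
cauchy (- x) ε 0<ε with cauchy x ε 0<ε
... | N , h = N , λ m n p q → close-neg (approx x m) (approx x n) (h m n p q)

_*_ : ℝ → ℝ → ℝ
approx (x * y) n = approx x n ℚ.* approx y n
cauchy (x * y) ε 0<ε =
  let (K , 0<K , A , a) = bounded x
      (L , 0<L , B , b) = bounded y
      (δ , 0<δ , eq) = divide (K ℚ.+ L) ε (ℚ.+-mono-< 0<K 0<L) 0<ε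
      (M , h) = cauchy x δ 0<δ
      (N , k) = cauchy y δ 0<δ
  in (A ⊔ B) ⊔ (M ⊔ N) , λ m n p q →
       let p₁ = ℕ.m⊔n≤o⇒m≤o (A ⊔ B) (M ⊔ N) p ; p₂ = ℕ.m⊔n≤o⇒n≤o (A ⊔ B) (M ⊔ N) p
           q₁ = ℕ.m⊔n≤o⇒m≤o (A ⊔ B) (M ⊔ N) q ; q₂ = ℕ.m⊔n≤o⇒n≤o (A ⊔ B) (M ⊔ N) q
       in close-* (approx x m) (approx x n) (approx y m) (approx y n) 0<K 0<L eq
            (a m (ℕ.m⊔n≤o⇒m≤o A B p₁)) (b n (ℕ.m⊔n≤o⇒n≤o A B q₁))
            (h m n (ℕ.m⊔n≤o⇒m≤o M N p₂) (ℕ.m⊔n≤o⇒m≤o M N q₂))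
            (k m n (ℕ.m⊔n≤o⇒n≤o M N p₂) (ℕ.m⊔n≤o⇒n≤o M N q₂))

≗⇒≈ : ∀ {x y} → (∀ n → approx x n ≡ approx y n) → x ≈ y
≗⇒≈ {x} {y} eq = mk≈ λ ε 0<ε → 0 , λ n _ →
  subst (λ r → ∣ approx x n ℚ.- r ∣ ℚ.< ε) (eq n) (∣q-q∣<ε {approx x n} 0<ε)

≈-refl : ∀ {x} → x ≈ x
≈-refl = ≗⇒≈ λ _ → refl

≈-sym : ∀ {x y} → x ≈ y → y ≈ x
≈-sym {x} {y} x≈y = mk≈ λ ε 0<ε → let (N , h) = close x≈y ε 0<ε in
  N , λ n p → close-sym (approx x n) (approx y n) (h n p)

≈-trans : ∀ {x y z} → x ≈ y → y ≈ z → x ≈ z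
≈-trans {x} {y} {z} x≈y y≈z = mk≈ λ ε 0<ε →
  let (M , h) = close x≈y (ε ℚ.* ½) (half ε 0<ε)
      (N , k) = close y≈z (ε ℚ.* ½) (half ε 0<ε)
  in M ⊔ N , λ n p → close-trans (approx x n) (approx y n) (approx z n)
       (h n (ℕ.m⊔n≤o⇒m≤o M N p)) (k n (ℕ.m⊔n≤o⇒n≤o M N p))

+-cong : ∀ {x x′ y y′} → x ≈ x′ → y ≈ y′ → x + y ≈ x′ + y′
+-cong {x} {x′} {y} {y′} x≈x′ y≈y′ = mk≈ λ ε 0<ε →
  let (M , h) = close x≈x′ (ε ℚ.* ½) (half ε 0<ε)
      (N , k) = close y≈y′ (ε ℚ.* ½) (half ε 0<ε)
  in M ⊔ N , λ n p → close-+ (approx x n) (approx x′ n) (approx y n) (approx y′ n)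
       (h n (ℕ.m⊔n≤o⇒m≤o M N p)) (k n (ℕ.m⊔n≤o⇒n≤o M N p))

-‿cong : ∀ {x x′} → x ≈ x′ → - x ≈ - x′
-‿cong {x} {x′} x≈x′ = mk≈ λ ε 0<ε → let (N , h) = close x≈x′ ε 0<ε in
  N , λ n p → close-neg (approx x n) (approx x′ n) (h n p)

*-cong : ∀ {x x′ y y′} → x ≈ x′ → y ≈ y′ → x * y ≈ x′ * y′
*-cong {x} {x′} {y} {y′} x≈x′ y≈y′ = mk≈ λ ε 0<ε →
  let (K , 0<K , A , a) = bounded x
      (L , 0<L , B , b) = bounded y′
      (δ , 0<δ , eq) = divide (K ℚ.+ L) ε (ℚ.+-mono-< 0<K 0<L) 0<ε
      (M , h) = close x≈x′ δ 0<δ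
      (N , k) = close y≈y′ δ 0<δ
  in (A ⊔ B) ⊔ (M ⊔ N) , λ n p →
       let p₁ = ℕ.m⊔n≤o⇒m≤o (A ⊔ B) (M ⊔ N) p ; p₂ = ℕ.m⊔n≤o⇒n≤o (A ⊔ B) (M ⊔ N) p
       in close-* (approx x n) (approx x′ n) (approx y n) (approx y′ n) 0<K 0<L eq
            (a n (ℕ.m⊔n≤o⇒m≤o A B p₁)) (b n (ℕ.m⊔n≤o⇒n≤o A B p₁))
            (h n (ℕ.m⊔n≤o⇒m≤o M N p₂)) (k n (ℕ.m⊔n≤o⇒n≤o M N p₂))

+-*-commutativeRing : CommutativeRing 0ℓ 0ℓ
+-*-commutativeRing = record
  { Carrier = ℝ ; _≈_ = _≈_ ; _+_ = _+_ ; _*_ = _*_ ; -_ = -_ ; 0# = 0ℝ ; 1# = 1ℝ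
  ; isCommutativeRing = record
    { isRing = record
      { +-isAbelianGroup = record
        { isGroup = record
          { isMonoid = record
            { isSemigroup = record
              { isMagma = record
                { isEquivalence = record { refl = ≈-refl ; sym = ≈-sym ; trans = ≈-trans }
                ; ∙-cong = +-cong }
              ; assoc = λ x y z → ≗⇒≈ λ n → ℚ.+-assoc (approx x n) (approx y n) (approx z n) }
            ; identity = (λ x → ≗⇒≈ λ n → ℚ.+-identityˡ (approx x n))
                       , (λ x → ≗⇒≈ λ n → ℚ.+-identityʳ (approx x n)) }
          ; inverse = (λ x → ≗⇒≈ λ n → ℚ.+-inverseˡ (approx x n))
                    , (λ x → ≗⇒≈ λ n → ℚ.+-inverseʳ (approx x n))
          ; ⁻¹-cong = -‿cong }
        ; comm = λ x y → ≗⇒≈ λ n → ℚ.+-comm (approx x n) (approx y n) }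
      ; *-cong = *-cong
      ; *-assoc = λ x y z → ≗⇒≈ λ n → ℚ.*-assoc (approx x n) (approx y n) (approx z n)
      ; *-identity = (λ x → ≗⇒≈ λ n → ℚ.*-identityˡ (approx x n))
                   , (λ x → ≗⇒≈ λ n → ℚ.*-identityʳ (approx x n))
      ; distrib = (λ x y z → ≗⇒≈ λ n → ℚ.*-distribˡ-+ (approx x n) (approx y n) (approx z n))
                , (λ x y z → ≗⇒≈ λ n → ℚ.*-distribʳ-+ (approx x n) (approx y n) (approx z n)) }
    ; *-comm = λ x y → ≗⇒≈ λ n → ℚ.*-comm (approx x n) (approx y n) } }

open SemiringSum (CommutativeRing.semiring +-*-commutativeRing) public using (sum)

------------------------------------------------------------------------
-- Convex and affine geometry in ℝⁿ

ℝ^ : ℕ → Set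
ℝ^ n = Vector ℝ n

infix 4 _≈ᵛ_

_≈ᵛ_ : ∀ {n} → ℝ^ n → ℝ^ n → Set
x ≈ᵛ y = ∀ i → x i ≈ y i

0ᵛ : ∀ {n} → ℝ^ n
0ᵛ _ = 0ℝ

combination : ∀ {n k} → Vector ℝ k → Vector (ℝ^ n) k → ℝ^ n
combination c p i = sum λ j → c j * p j i

conv : ∀ {n} → Pred (ℝ^ n) 0ℓ → Pred (ℝ^ n) 0ℓ
conv {n} S x =
  ∃[ k ] Σ[ c ∈ Vector ℝ k ] Σ[ p ∈ Vector (ℝ^ n) k ]
    (∀ j → p j ∈ S) × (∀ j → 0ℝ ≤ c j) × sum c ≈ 1ℝ × x ≈ᵛ combination c p

aff : ∀ {n} → Pred (ℝ^ n) 0ℓ → Pred (ℝ^ n) 0ℓ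
aff {n} S x =
  ∃[ k ] Σ[ c ∈ Vector ℝ k ] Σ[ p ∈ Vector (ℝ^ n) k ]
    (∀ j → p j ∈ S) × sum c ≈ 1ℝ × x ≈ᵛ combination c p

range : ∀ {n k} → Vector (ℝ^ n) k → Pred (ℝ^ n) 0ℓ
range p x = ∃[ j ] x ≈ᵛ p j

AffinelyIndependent : ∀ {n k} → Vector (ℝ^ n) k → Set
AffinelyIndependent {k = k} p =
  (c : Vector ℝ k) → sum c ≈ 0ℝ → combination c p ≈ᵛ 0ᵛ → ∀ j → c j ≈ 0ℝ

-- A nonempty affine subspace has dimension d when it has an affine basis of
-- d + 1 points.
AffineDimension : ∀ {n} → Pred (ℝ^ n) 0ℓ → ℕ → Set
AffineDimension {n} A d =
  Σ[ p ∈ Vector (ℝ^ n) (suc d) ]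
    (∀ j → p j ∈ A) × AffinelyIndependent p × A ⊆ aff (range p)

-- Dimension is a relation rather than a function, as a basis cannot be
-- computed from an arbitrary predicate.
Dim : ∀ {n} → Pred (ℝ^ n) 0ℓ → ℕ → Set
Dim P d = AffineDimension (aff P) d

------------------------------------------------------------------------
-- Parking functions

-- With i counted from 0, this sums the entries of b at positions 0, …, i,
-- i.e. it is b₁ + ⋯ + bᵢ for the 1-based index of the same entry.
partialSum : ∀ {n} → Vector ℕ n → Fin n → ℕ
partialSum b i = sumℕ λ (j : Fin (suc (toℕ i))) → b (inject≤ j (toℕ<n i))
  where open SemiringSum ℕ.+-*-semiring renaming (sum to sumℕ)

Nondecreasing : ∀ {n} → Vector ℕ n → Set
Nondecreasing β = ∀ i j → toℕ i ℕ.≤ toℕ j → β i ℕ.≤ β j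

-- The nondecreasing rearrangement β′ exists and is unique, so quantifying it
-- existentially is no restriction.
IsParkingFunction : ∀ {n} → Vector ℕ n → Vector ℕ n → Set
IsParkingFunction {n} b β =
  (∀ i → 0 ℕ.< β i) ×
  Σ[ β′ ∈ Vector ℕ n ] β ↭ β′ × Nondecreasing β′ × (∀ i → β′ i ℕ.≤ partialSum b i)

parkingFunctions : ∀ {n} → Vector ℕ n → Pred (ℝ^ n) 0ℓ
parkingFunctions {n} b x =
  Σ[ β ∈ Vector ℕ n ] IsParkingFunction b β × x ≈ᵛ (λ i → fromℕ (β i))

𝔛 : ∀ {n} → Vector ℕ n → Pred (ℝ^ n) 0ℓ
𝔛 b = conv (parkingFunctions b)

{-# OPTIONS --safe #-}
-- The point (1,…,1) and its n translates by unit vectors are b-parking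
-- functions as soon as b₁ + ⋯ + bₙ ≥ 2, which fails only for n = 1 = b₁.
-- In the combination Σⱼ cⱼ pⱼ of these points the i-th coordinate is
-- Σⱼ cⱼ + cᵢ, so they are affinely independent and span ℝⁿ.  In the
-- exceptional case (1) is the only parking function.
module Submission where

open import Algebra.Bundles using (CommutativeRing)
import Data.Fin as Fin
open import Data.Fin using (Fin; zero; suc; toℕ; fromℕ<; punchIn)
open import Data.Fin.Permutation using (transpose; _⟨$⟩ʳ_) renaming (id to idₚ)
open import Data.Fin.Properties using (_≟_; ≤fromℕ; punchInᵢ≢i; toℕ-injective)
open import Data.Nat using (ℕ; zero; suc; _<_; z≤n; s≤s)
import Data.Nat as ℕ
import Data.Nat.Properties as ℕ
open import Data.Product using (_×_; _,_)
open import Data.Rational using (0ℚ; 1ℚ)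
import Data.Rational as ℚ
import Data.Rational.Properties as ℚ
open import Data.Vec.Functional using (Vector; _∷_; replicate; updateAt; removeAt)
open import Data.Vec.Functional.Properties using (updateAt-updates; updateAt-minimal)
open import Data.Vec.Functional.Relation.Binary.Permutation using (_↭_)
open import Function using (_∘_)
open import Level using (0ℓ)
open import Relation.Binary.PropositionalEquality as ≡ using (_≡_; _≢_; refl; cong; subst)
open import Relation.Nullary using (¬_; yes; no)
open import Relation.Unary using (Pred; _∈_; _⊆_)

import Algebra.Properties.AbelianGroup
import Algebra.Properties.CommutativeSemigroup
import Algebra.Properties.Semiring.Sum as SemiringSum
import Relation.Binary.Reasoning.Setoid

-- Over an abstract ring, since Agda tends to unfold the Cauchy moduli when it
-- infers arguments of type ℝ.
module BarycentricCoordinates {a ℓ} (R : CommutativeRing a ℓ) where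

  open CommutativeRing R hiding (refl; zero)
  open SemiringSum semiring
  open Algebra.Properties.AbelianGroup +-abelianGroup using (xyx⁻¹≈y; //-rightDividesˡ)
  open Algebra.Properties.CommutativeSemigroup +-commutativeSemigroup using (xy∙z≈xz∙y)
  open Relation.Binary.Reasoning.Setoid setoid

  sum-singleton : (c : Vector Carrier 1) → sum c ≈ c zero
  sum-singleton c = +-identityʳ (c zero)

  weighted-constant : ∀ {k} (c q : Vector Carrier k) x → sum c ≈ 1# → (∀ j → q j ≈ x) →
                      sum (λ j → c j * q j) ≈ x
  weighted-constant c q x Σc≈1 q≈x = begin
    sum (λ j → c j * q j)      ≈⟨ sum-cong-≋ (λ j → *-congˡ (q≈x j)) ⟩
    sum (λ j → c j * x)        ≈⟨ *-distribʳ-sum x c ⟨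
    sum c * x                  ≈⟨ *-congʳ Σc≈1 ⟩
    1# * x                     ≈⟨ *-identityˡ x ⟩
    x                          ∎

  -- Splitting off index `i` leaves `c i + c i` plus the other weights; one copy of `c i` completes
  -- the full sum and the other is the surplus.
  weighted-bump : ∀ {n} (c q : Vector Carrier n) i → q i ≈ 1# + 1# → (∀ j → i ≢ j → q j ≈ 1#) →
                  sum (λ j → c j * q j) ≈ sum c + c i
  weighted-bump {suc n} c q i q≈2 q≈1 = begin
    sum (λ j → c j * q j)
      ≈⟨ sum-remove {i = i} (λ j → c j * q j) ⟩
    c i * q i + sum (λ j → c (punchIn i j) * q (punchIn i j))
      ≈⟨ +-cong at-i (sum-cong-≋ away) ⟩
    c i + c i + sum (removeAt c i)
      ≈⟨ xy∙z≈xz∙y (c i) (c i) (sum (removeAt c i)) ⟩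
    c i + sum (removeAt c i) + c i
      ≈⟨ +-congʳ (sum-remove c) ⟨
    sum c + c i
      ∎
    where
    at-i : c i * q i ≈ c i + c i
    at-i = begin
      c i * q i              ≈⟨ *-congˡ q≈2 ⟩
      c i * (1# + 1#)        ≈⟨ distribˡ (c i) 1# 1# ⟩
      c i * 1# + c i * 1#    ≈⟨ +-cong (*-identityʳ (c i)) (*-identityʳ (c i)) ⟩
      c i + c i              ∎
    away : ∀ j → c (punchIn i j) * q (punchIn i j) ≈ c (punchIn i j)
    away j = trans (*-congˡ (q≈1 (punchIn i j) (punchInᵢ≢i i j ∘ ≡.sym))) (*-identityʳ _)

  -- Cancelling `sum c` kills every tail entry, and then the head is all that remains of the
  -- vanishing sum.
  coordinates-vanish : ∀ {n} (c : Vector Carrier (suc n)) → sum c ≈ 0# →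
                       (∀ i → sum c + c (suc i) ≈ 0#) → ∀ j → c j ≈ 0#
  coordinates-vanish {n} c Σc≈0 Σc+cᵢ≈0 = λ { zero → c₀≈0 ; (suc i) → cᵢ≈0 i }
    where
    cᵢ≈0 : ∀ i → c (suc i) ≈ 0#
    cᵢ≈0 i = begin
      c (suc i)            ≈⟨ +-identityˡ (c (suc i)) ⟨
      0# + c (suc i)       ≈⟨ +-congʳ Σc≈0 ⟨
      sum c + c (suc i)    ≈⟨ Σc+cᵢ≈0 i ⟩
      0#                   ∎
    c₀≈0 : c zero ≈ 0#
    c₀≈0 = begin
      c zero                           ≈⟨ +-identityʳ (c zero) ⟨
      c zero + 0#                      ≈⟨ +-congˡ (sum-replicate-zero n) ⟨
      c zero + sum (replicate n 0#)    ≈⟨ +-congˡ (sum-cong-≋ cᵢ≈0) ⟨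
      sum c                            ≈⟨ Σc≈0 ⟩
      0#                               ∎

  -- Barycentric coordinates with respect to `simplex`: when the weights total 1, coordinate `i` of
  -- a combination is 1 plus weight `suc i`, which forces the tail; the head brings the total to 1.
  coordinates : ∀ {n} → Vector Carrier n → Vector Carrier (suc n)
  coordinates x = (1# + - sum d) ∷ d
    where d = λ i → x i + - 1#

  sum-coordinates : ∀ {n} (x : Vector Carrier n) → sum (coordinates x) ≈ 1#
  sum-coordinates x = //-rightDividesˡ _ 1#

  coordinates-recover : ∀ {n} (x : Vector Carrier n) i →
                        sum (coordinates x) + coordinates x (suc i) ≈ x i
  coordinates-recover x i = begin
    sum (coordinates x) + (x i + - 1#)    ≈⟨ +-congʳ (sum-coordinates x) ⟩
    1# + (x i + - 1#)                     ≈⟨ +-assoc 1# (x i) (- 1#) ⟨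
    1# + x i + - 1#                       ≈⟨ xyx⁻¹≈y 1# (x i) ⟩
    x i                                   ∎

open import Defs
open BarycentricCoordinates +-*-commutativeRing

-- Convex and affine hulls

0≤1 : 0ℝ ≤ 1ℝ
0≤1 = mk≤ λ ε 0<ε → 0 , λ _ _ → ℚ.<-trans (ℚ.negative⁻¹ (0ℚ ℚ.- 1ℚ)) 0<ε

fromℕ2≈1+1 : fromℕ 2 ≈ 1ℝ + 1ℝ
fromℕ2≈1+1 = ≗⇒≈ λ _ → refl

combination-constant : ∀ {n k} (c : Vector ℝ k) (p : Vector (ℝ^ n) k) (x : ℝ^ n) →
                       sum c ≈ 1ℝ → (∀ j → p j ≈ᵛ x) → combination c p ≈ᵛ x
combination-constant c p x Σc≈1 p≈x i =
  weighted-constant c (λ j → p j i) (x i) Σc≈1 (λ j → p≈x j i)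

S⊆conv : ∀ {n} {S : Pred (ℝ^ n) 0ℓ} → S ⊆ conv S
S⊆conv {x = x} x∈S =
  1 , c , (λ _ → x) , (λ _ → x∈S) , (λ _ → 0≤1) , sum-singleton c ,
  λ i → ≈-sym (combination-constant c (λ _ → x) x (sum-singleton c) (λ _ _ → ≈-refl) i)
  where c = replicate 1 1ℝ

S⊆aff : ∀ {n} {S : Pred (ℝ^ n) 0ℓ} → S ⊆ aff S
S⊆aff {x = x} x∈S =
  1 , c , (λ _ → x) , (λ _ → x∈S) , sum-singleton c ,
  λ i → ≈-sym (combination-constant c (λ _ → x) x (sum-singleton c) (λ _ _ → ≈-refl) i)
  where c = replicate 1 1ℝ

conv-constant : ∀ {n} {S : Pred (ℝ^ n) 0ℓ} {y} → (∀ {x} → x ∈ S → x ≈ᵛ y) →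
                ∀ {x} → x ∈ conv S → x ≈ᵛ y
conv-constant {y = y} S≈y (_ , c , p , p∈S , _ , Σc≈1 , x≈) i =
  ≈-trans (x≈ i) (combination-constant c p y Σc≈1 (λ j → S≈y (p∈S j)) i)

aff-constant : ∀ {n} {S : Pred (ℝ^ n) 0ℓ} {y} → (∀ {x} → x ∈ S → x ≈ᵛ y) →
               ∀ {x} → x ∈ aff S → x ≈ᵛ y
aff-constant {y = y} S≈y (_ , c , p , p∈S , Σc≈1 , x≈) i =
  ≈-trans (x≈ i) (combination-constant c p y Σc≈1 (λ j → S≈y (p∈S j)) i)

-- Parking functions with at most one entry 2, all others 1

ones : ∀ {n} → Vector ℕ n
ones = replicate _ 1

bump : ∀ {n} → Fin n → Vector ℕ n
bump k = updateAt ones k suc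

bump-same : ∀ {n} (k : Fin n) → bump k k ≡ 2
bump-same k = updateAt-updates k ones

bump-other : ∀ {n} {k i : Fin n} → i ≢ k → bump k i ≡ 1
bump-other {k = k} {i} = updateAt-minimal i k ones

bump-positive : ∀ {n} (k i : Fin n) → 0 < bump k i
bump-positive k i with i ≟ k
... | yes refl = subst (0 <_) (≡.sym (bump-same k)) (s≤s z≤n)
... | no i≢k   = subst (0 <_) (≡.sym (bump-other i≢k)) (s≤s z≤n)

bump-↭ : ∀ {n} (k l : Fin n) → bump k ↭ bump l
bump-↭ k l = transpose l k , eq
  where
  eq : ∀ i → bump k (transpose l k ⟨$⟩ʳ i) ≡ bump l i
  -- The case splits follow the tests inside `transpose l k`, so its value at `i` reduces to `k`,
  -- `l` and `i` in turn.
  eq i with i ≟ l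
  ... | yes refl = ≡.trans (bump-same k) (≡.sym (bump-same l))
  ... | no i≢l with i ≟ k
  ...   | yes refl = ≡.trans (bump-other (i≢l ∘ ≡.sym)) (≡.sym (bump-other i≢l))
  ...   | no i≢k   = ≡.trans (bump-other i≢k) (≡.sym (bump-other i≢l))

bump-last-nondecreasing : ∀ m → Nondecreasing (bump (Fin.fromℕ m))
bump-last-nondecreasing m i j i≤j with i ≟ Fin.fromℕ m
... | no i≢last = subst (ℕ._≤ _) (≡.sym (bump-other i≢last)) (bump-positive (Fin.fromℕ m) j)
-- Only the last position holds a 2, and no later `j` exists, so `j` is that position too.
... | yes refl  = ℕ.≤-reflexive (cong (bump (Fin.fromℕ m)) {Fin.fromℕ m} {j} last≡j)
  where last≡j = toℕ-injective (ℕ.≤-antisym i≤j (≤fromℕ j))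

partialSum-positive : ∀ {n} {b : Vector ℕ n} → (∀ i → 0 < b i) → ∀ i → 0 < partialSum b i
partialSum-positive 0<b i = ℕ.+-mono-≤ (0<b _) z≤n

1<partialSum-last : ∀ m {b : Vector ℕ (suc m)} → (∀ i → 0 < b i) →
                    ¬ (suc m ≡ 1 × b zero ≡ 1) → 1 < partialSum b (Fin.fromℕ m)
-- With one entry, excluding `b zero ≡ 1` leaves an entry of at least 2; with more entries, two
-- positive summands suffice.
1<partialSum-last zero {b} 0<b ¬exc =
  ℕ.+-mono-≤ (ℕ.≤∧≢⇒< (0<b zero) (λ 1≡b₀ → ¬exc (refl , ≡.sym 1≡b₀))) z≤n
1<partialSum-last (suc m) 0<b _ = ℕ.+-mono-≤ (0<b _) (ℕ.+-mono-≤ (0<b _) z≤n)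

ones-parking : ∀ {n} {b : Vector ℕ n} → (∀ i → 0 < b i) → IsParkingFunction b ones
ones-parking 0<b =
  (λ _ → s≤s z≤n) , ones , (idₚ , λ _ → refl) , (λ _ _ _ → ℕ.≤-refl) , partialSum-positive 0<b

-- Every `bump k` has the same sorted form, with the 2 in last place. So only the total of `b` has
-- to reach 2, while the earlier bounds ask for 1.
bump-parking : ∀ {m} {b : Vector ℕ (suc m)} → (∀ i → 0 < b i) →
               1 < partialSum b (Fin.fromℕ m) → ∀ k → IsParkingFunction b (bump k)
bump-parking {m} {b} 0<b 1<Σb k =
  bump-positive k , bump last , bump-↭ k last , bump-last-nondecreasing m , bound
  where
  last = Fin.fromℕ m
  bound : ∀ i → bump last i ℕ.≤ partialSum b i
  bound i with i ≟ last
  ... | yes refl = subst (ℕ._≤ partialSum b last) (≡.sym (bump-same last)) 1<Σb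
  ... | no i≢l   = subst (ℕ._≤ partialSum b i) (≡.sym (bump-other i≢l)) (partialSum-positive 0<b i)

-- The simplex as an affine basis

simplex : ∀ {n} → Vector (ℝ^ n) (suc n)
simplex = (λ _ → 1ℝ) ∷ λ k i → fromℕ (bump k i)

-- Stated for a variable k: over suc n points Agda would unfold the sums and
-- compare their Cauchy moduli, exhausting memory.
combination-bump : ∀ {n k} (c : Vector ℝ k) (p : Vector (ℝ^ n) k) j i → p j i ≈ 1ℝ + 1ℝ →
                   (∀ l → j ≢ l → p l i ≈ 1ℝ) → combination c p i ≈ sum c + c j
combination-bump c p j i = weighted-bump c (λ l → p l i) j

-- In coordinate `i` the vertex with index `suc i` has entry 2 and all other vertices have 1; the
-- shift comes from vertex `zero` being the all-ones point.
combination-simplex : ∀ {n} (c : Vector ℝ (suc n)) →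
                      combination c simplex ≈ᵛ λ i → sum c + c (suc i)
combination-simplex c i = combination-bump c simplex (suc i) i on off
  where
  on : simplex (suc i) i ≈ 1ℝ + 1ℝ
  on = subst (λ t → fromℕ t ≈ 1ℝ + 1ℝ) (≡.sym (bump-same i)) fromℕ2≈1+1
  off : ∀ j → suc i ≢ j → simplex j i ≈ 1ℝ
  off zero    _   = ≈-refl
  off (suc k) i≢k = subst (λ t → fromℕ t ≈ 1ℝ) (≡.sym (bump-other (i≢k ∘ cong suc))) ≈-refl

simplex-independent : ∀ {n} → AffinelyIndependent (simplex {n})
simplex-independent c Σc≈0 comb≈0 =
  coordinates-vanish c Σc≈0 λ i → ≈-trans (≈-sym (combination-simplex c i)) (comb≈0 i)

simplex-spans : ∀ {n} (x : ℝ^ n) → x ∈ aff (range simplex)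
simplex-spans {n} x =
  suc n , coordinates x , simplex , (λ j → j , λ _ → ≈-refl) , sum-coordinates x ,
  λ i → ≈-sym (≈-trans (combination-simplex (coordinates x) i) (coordinates-recover x i))

full-dimension : ∀ {m} {b : Vector ℕ (suc m)} → (∀ i → 0 < b i) →
                 1 < partialSum b (Fin.fromℕ m) → Dim (𝔛 b) (suc m)
full-dimension {m} {b} 0<b 1<Σb =
  simplex , simplex∈aff , simplex-independent , λ {x} _ → simplex-spans x
  where
  simplex-parking : ∀ j → simplex j ∈ parkingFunctions b
  simplex-parking zero    = ones , ones-parking 0<b , λ _ → ≈-refl
  simplex-parking (suc k) = bump k , bump-parking 0<b 1<Σb k , λ _ → ≈-refl
  simplex∈aff : ∀ j → simplex j ∈ aff (𝔛 b)
  simplex∈aff j = S⊆aff {S = 𝔛 b} (S⊆conv {S = parkingFunctions b} (simplex-parking j))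

-- The exceptional case of a single point

point-dimension : ∀ {n} {S : Pred (ℝ^ n) 0ℓ} {y} → y ∈ S → (∀ {x} → x ∈ S → x ≈ᵛ y) →
                  AffineDimension S 0
point-dimension {y = y} y∈S S≈y =
  (λ _ → y) , (λ _ → y∈S) ,
  -- For a single point the sum of the weights is its only weight, so independence is immediate.
  (λ { c Σc≈0 _ zero → ≈-trans (≈-sym (sum-singleton c)) Σc≈0 }) ,
  λ x∈S → S⊆aff {S = range _} (zero , S≈y x∈S)

parking-unique : ∀ {b : Vector ℕ 1} → b zero ≡ 1 →
                 ∀ {x} → x ∈ parkingFunctions b → x ≈ᵛ λ _ → 1ℝ
parking-unique {b} b₀≡1 {x} (β , (0<β , β′ , (ρ , βρ≡β′) , _ , β′≤) , x≈β) zero =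
  subst (λ t → x zero ≈ fromℕ t) (ℕ.≤-antisym β₀≤1 (0<β zero)) (x≈β zero)
  where
  Fin1-unique : (i : Fin 1) → i ≡ zero
  Fin1-unique zero = refl
  β₀≤1 : β zero ℕ.≤ 1
  β₀≤1 = ℕ.≤-trans
    -- A permutation of `Fin 1` fixes `zero`, so `β` and its rearrangement agree there.
    (ℕ.≤-reflexive (≡.trans (cong β (≡.sym (Fin1-unique (ρ ⟨$⟩ʳ zero)))) (βρ≡β′ zero)))
    -- The one-term partial sum unfolds to `b zero + 0`.
    (ℕ.≤-trans (β′≤ zero) (ℕ.≤-reflexive (cong (ℕ._+ 0) b₀≡1)))

proposition2p2 : (n : ℕ) (0<n : 0 < n) (b : Vector ℕ n) → (∀ i → 0 < b i) →
    (¬ (n ≡ 1 × b (fromℕ< 0<n) ≡ 1) → Dim (𝔛 b) n) ×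
    (n ≡ 1 × b (fromℕ< 0<n) ≡ 1 → Dim (𝔛 b) 0)
proposition2p2 (suc m) _ b 0<b =
  (λ ¬exc → full-dimension {b = b} 0<b (1<partialSum-last m {b} 0<b ¬exc)) ,
  -- The point (1) is itself a parking function, and neither the convex nor the affine hull adds
  -- anything to a single point.
  λ { (refl , b₀≡1) → point-dimension {S = aff (𝔛 b)}
        (S⊆aff {S = 𝔛 b} (S⊆conv {S = parkingFunctions b}
          (ones , ones-parking 0<b , λ _ → ≈-refl)))
        (aff-constant {S = 𝔛 b} (conv-constant {S = parkingFunctions b}
          (parking-unique {b} b₀≡1))) }
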